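{- Let $s_0,t_0\ge 1$ be real numbers and let $\mathcal T$ be the infinite rooted tree of nodes generated from $(s_0,t_0)$ by the recursive rule described in the context. Then the set of accumulation points in $\mathbb R^2$ of the set of locations of the nodes of $\mathcal T$ is exactly the closed segment with extremities $(-1,s_0)$ and $(1,t_0)$, i.e. the set $\{(x,\,\tfrac{s_0+t_0}{2}+\tfrac{t_0-s_0}{2}x): x\in[-1,1]\}$.
   Context: Points of $\mathbb R^2$ are written $(x,y)$ (abscissa = space, ordinate = time). Given real numbers $s_0,t_0\ge 1$, a tree $\mathcal T$ is built recursively. Each node has a location $(x,y)\in\mathbb R^2$, a depth $d\in\mathbb N$ (the number of its ancestors that are split nodes), and a pair of real parameters $(s,t)$. The root is at $(0,0)$, has depth $0$ and parameters $(s_0,t_0)$. A node at $(x,y)$ of depth $d$ with parameters $(s,t)$ is: - a delay node if $s\ge 2$ and $t\ge 2$; it then has exactly one child, located at $(x,\,y+2^{ -d})$, of depth $d$, with parameters $(s-1,\,t-1)$; - a split node otherwise (i.e. if $s<2$ or $t<2$); it then has exactly two children, both of depth $d+1$: a left child at $(x-2^{ -(d+1)},\,y+2^{ -(d+1)})$ with parameters $(2s-1,\,s+t-1)$, and a right child at $(x+2^{ -(d+1)},\,y+2^{ -(d+1)})$ with parameters $(s+t-1,\,2t-1)$. The recursion never stops, so $\mathcal T$ is infinite; each node is joined to its children by straight edges. -}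

module Defs where

open import Algebra.Bundles using (CommutativeRing)
open import Data.Nat.Base as ℕ using (ℕ)
open import Data.Product.Base using (_×_; _,_; ∃; ∃-syntax)
open import Data.Product.Relation.Binary.Pointwise.NonDependent using (Pointwise)
open import Data.Sum.Base using (_⊎_)
open import Level using (0ℓ)
open import Relation.Binary.Core using (Rel)
open import Relation.Binary.Structures using (IsTotalOrder)
open import Relation.Nullary.Negation.Core using (¬_)
open import Relation.Unary using (Pred; _∈_; Satisfiable)

import Relation.Binary.Construct.NonStrictToStrict as ToStrict
import Algebra.Properties.Semiring.Exp as Exp

-- The real numbers, given by the classical axioms that determine them up to
-- isomorphism: a totally ordered field in which every inhabited subset that is
-- bounded above has a least upper bound.  These are the textbook axioms read in
-- classical logic, so results about this structure take excluded middle as a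
-- hypothesis.
record CompleteOrderedField : Set₁ where
  infix  8 _⁻¹
  infixl 7 _/_
  infix  4 _≤_ _<_

  field
    commutativeRing : CommutativeRing 0ℓ 0ℓ

  open CommutativeRing commutativeRing public

  field
    -- Total for convenience; the value of 0# ⁻¹ is unspecified.
    _⁻¹          : Carrier → Carrier
    ⁻¹-cong      : ∀ {x y} → x ≈ y → x ⁻¹ ≈ y ⁻¹
    *-inverseʳ   : ∀ {x} → x ≉ 0# → x * x ⁻¹ ≈ 1#
    0≉1          : 0# ≉ 1#
    _≤_          : Rel Carrier 0ℓ
    isTotalOrder : IsTotalOrder _≈_ _≤_
    +-monoˡ-≤    : ∀ {x y} z → x ≤ y → x + z ≤ y + z
    *-nonneg     : ∀ {x y} → 0# ≤ x → 0# ≤ y → 0# ≤ x * y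

  UpperBound : Pred Carrier 0ℓ → Pred Carrier 0ℓ
  UpperBound A u = ∀ {x} → x ∈ A → x ≤ u

  field
    supremum : (A : Pred Carrier 0ℓ) → Satisfiable A → ∃ (UpperBound A) →
               ∃[ u ] UpperBound A u × (∀ {v} → UpperBound A v → u ≤ v)

  _<_ : Rel Carrier 0ℓ
  _<_ = ToStrict._<_ _≈_ _≤_

  _/_ : Carrier → Carrier → Carrier
  x / y = x * y ⁻¹

  2# : Carrier
  2# = 1# + 1#

  open Exp semiring public using (_^_)

  2^-_ : ℕ → Carrier
  2^- d = (2# ^ d) ⁻¹

module Plane (ℝ : CompleteOrderedField) where
  open CompleteOrderedField ℝ

  Point : Set
  Point = Carrier × Carrier

  infix 4 _≈ₚ_
  _≈ₚ_ : Rel Point 0ℓ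
  _≈ₚ_ = Pointwise _≈_ _≈_

  -- Squared Euclidean distance: there is no need for square roots, since for
  -- ε > 0 being at distance < ε means that dist² < ε * ε.
  dist² : Point → Point → Carrier
  dist² (x₁ , y₁) (x₂ , y₂) = (x₁ - x₂) * (x₁ - x₂) + (y₁ - y₂) * (y₁ - y₂)

  AccumulationPoint : Pred Point 0ℓ → Pred Point 0ℓ
  AccumulationPoint A p =
    ∀ ε → 0# < ε → ∃[ q ] q ∈ A × ¬ (q ≈ₚ p) × dist² p q < ε * ε

  ClosedSegment : Point → Point → Pred Point 0ℓ
  ClosedSegment (x₁ , y₁) (x₂ , y₂) p =
    ∃[ r ] 0# ≤ r × r ≤ 1# ×
      p ≈ₚ ((1# - r) * x₁ + r * x₂ , (1# - r) * y₁ + r * y₂)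

  SegmentGraph : Carrier → Carrier → Pred Point 0ℓ
  SegmentGraph s₀ t₀ p =
    ∃[ x ] - 1# ≤ x × x ≤ 1# ×
      p ≈ₚ (x , (s₀ + t₀) / 2# + (t₀ - s₀) / 2# * x)

module Tree (ℝ : CompleteOrderedField) where
  open CompleteOrderedField ℝ
  open Plane ℝ

  record Node : Set where
    constructor node
    field
      location : Point
      depth    : ℕ
      s t      : Carrier

  open Node public using (location; depth)

  root : Carrier → Carrier → Node
  root s₀ t₀ = node (0# , 0#) 0 s₀ t₀

  IsDelay IsSplit : Node → Set
  IsDelay (node _ _ s t) = 2# ≤ s × 2# ≤ t
  IsSplit (node _ _ s t) = s < 2# ⊎ t < 2#

  delayChild leftChild rightChild : Node → Node
  delayChild (node (x , y) d s t) =
    node (x , y + 2^- d) d (s - 1#) (t - 1#)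
  leftChild (node (x , y) d s t) =
    node (x - 2^- (ℕ.suc d) , y + 2^- (ℕ.suc d)) (ℕ.suc d)
         (2# * s - 1#) (s + t - 1#)
  rightChild (node (x , y) d s t) =
    node (x + 2^- (ℕ.suc d) , y + 2^- (ℕ.suc d)) (ℕ.suc d)
         (s + t - 1#) (2# * t - 1#)

  data 𝒯 (s₀ t₀ : Carrier) : Pred Node 0ℓ where
    root∈  : root s₀ t₀ ∈ 𝒯 s₀ t₀
    delay∈ : ∀ {n} → n ∈ 𝒯 s₀ t₀ → IsDelay n → delayChild n ∈ 𝒯 s₀ t₀
    left∈  : ∀ {n} → n ∈ 𝒯 s₀ t₀ → IsSplit n → leftChild n ∈ 𝒯 s₀ t₀
    right∈ : ∀ {n} → n ∈ 𝒯 s₀ t₀ → IsSplit n → rightChild n ∈ 𝒯 s₀ t₀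

  Locations : Carrier → Carrier → Pred Point 0ℓ
  Locations s₀ t₀ q = ∃[ n ] n ∈ 𝒯 s₀ t₀ × q ≈ₚ location n

{-# OPTIONS --safe #-}

-- A node at (x , y) of depth d with parameters (s , t) aims at the segment from
-- (x − 2⁻ᵈ , y + 2⁻ᵈ s) to (x + 2⁻ᵈ , y + 2⁻ᵈ t).  A delay node and its child aim
-- at the same segment; the children of a split node aim at its two halves.  The
-- difference t − s is constant along the tree and a split needs s < 2 or t < 2,
-- so s + t stays bounded.  Hence a node of depth d lies within O(2⁻ᵈ) of its
-- segment (but strictly below it), and there are finitely many nodes of each
-- depth: accumulation points are limits of nodes of unbounded depth, which lie on
-- the target segment, while halving leads to nodes of every depth near each of
-- its points.
module Submission where

open import Defs
open import Algebra.Bundles using (CommutativeRing)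
open import Algebra.Solver.Ring.AlmostCommutativeRing using (_-Raw-AlmostCommutative⟶_; fromCommutativeRing)
open import Axiom.ExcludedMiddle using (ExcludedMiddle)
open import Data.Empty using (⊥-elim)
open import Data.Integer.Base as ℤ using (ℤ; +_; -[1+_])
open import Data.List.Base using (List; []; _∷_; concatMap; upTo)
open import Data.List.Membership.Propositional using () renaming (_∈_ to _∈ₗ_)
open import Data.List.Membership.Propositional.Properties using (∈-concatMap⁺; ∈-upTo⁺)
open import Data.List.Relation.Unary.Any as Any using (here; there)
open import Data.Maybe.Base as Maybe using (Maybe)
open import Data.Nat.Base as ℕ using (ℕ; zero; suc; z≤n; s≤s)
open import Data.Product.Base using (_×_; _,_; proj₁; proj₂; ∃-syntax)
open import Data.Sum.Base using (_⊎_; inj₁; inj₂)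
open import Level using (0ℓ)
open import Relation.Binary.Structures using (IsTotalOrder)
open import Relation.Nullary.Decidable.Core using (Dec; yes; no; dec⇒maybe)
open import Relation.Nullary.Negation.Core using (¬_)
open import Relation.Unary using (_∈_; _≐_)

import Algebra.Properties.AbelianGroup as AbelianGroupProperties
import Algebra.Properties.Ring as RingProperties
import Algebra.Properties.Semiring.Mult.TCOptimised as Mult
import Algebra.Solver.Ring
import Data.Integer.Properties as ℤ
import Data.Nat.Properties as ℕ
import Data.Sign.Base as Sign
import Relation.Binary.Construct.NonStrictToStrict as ToStrict
import Relation.Binary.PropositionalEquality.Core as ≡
import Relation.Binary.Reasoning.Setoid

-- The ring solver with integer coefficients over a commutative ring

module IntegerCoefficients (R : CommutativeRing 0ℓ 0ℓ) where
  open CommutativeRing R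
  open RingProperties ring
  open AbelianGroupProperties +-abelianGroup using (⁻¹-∙-comm; ⁻¹-involutive; ε⁻¹≈ε)
  open Mult semiring using (×-homo-+; ×1-homo-*; 1+×) renaming (_×_ to _·_)
  open Relation.Binary.Reasoning.Setoid setoid

  fromℕ : ℕ → Carrier
  fromℕ n = n · 1#

  fromℤ : ℤ → Carrier
  fromℤ (+ n)    = fromℕ n
  fromℤ -[1+ n ] = - fromℕ (suc n)

  fromℕ-suc : ∀ n → fromℕ (suc n) ≈ 1# + fromℕ n
  fromℕ-suc n = 1+× n 1#

  fromℤ-⊖ : ∀ m n → fromℤ (m ℤ.⊖ n) ≈ fromℕ m - fromℕ n
  fromℤ-⊖ zero    zero    = sym (-‿inverseʳ 0#)
  fromℤ-⊖ (suc m) zero    = sym (trans (+-congˡ ε⁻¹≈ε) (+-identityʳ _))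
  fromℤ-⊖ zero    (suc n) = sym (+-identityˡ _)
  fromℤ-⊖ (suc m) (suc n) = begin
    fromℤ (suc m ℤ.⊖ suc n)                  ≡⟨ ≡.cong fromℤ (ℤ.[1+m]⊖[1+n]≡m⊖n m n) ⟩
    fromℤ (m ℤ.⊖ n)                          ≈⟨ fromℤ-⊖ m n ⟩
    fromℕ m - fromℕ n                        ≈⟨ +-congʳ (+-identityʳ _) ⟨
    fromℕ m + 0# - fromℕ n                   ≈⟨ +-congʳ (+-congˡ (-‿inverseʳ 1#)) ⟨
    fromℕ m + (1# - 1#) - fromℕ n            ≈⟨ +-congʳ (+-assoc _ _ _) ⟨
    fromℕ m + 1# - 1# - fromℕ n              ≈⟨ +-assoc _ _ _ ⟩
    fromℕ m + 1# + (- 1# - fromℕ n)          ≈⟨ +-cong (+-comm _ _) (⁻¹-∙-comm _ _) ⟩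
    1# + fromℕ m - (1# + fromℕ n)            ≈⟨ +-cong (fromℕ-suc m) (-‿cong (fromℕ-suc n)) ⟨
    fromℕ (suc m) - fromℕ (suc n)            ∎

  fromℤ-+ : ∀ i j → fromℤ (i ℤ.+ j) ≈ fromℤ i + fromℤ j
  fromℤ-+ (+ m)    (+ n)    = ×-homo-+ 1# m n
  fromℤ-+ (+ m)    -[1+ n ] = fromℤ-⊖ m (suc n)
  fromℤ-+ -[1+ m ] (+ n)    = trans (fromℤ-⊖ n (suc m)) (+-comm _ _)
  fromℤ-+ -[1+ m ] -[1+ n ] = begin
    - fromℕ (suc (suc (m ℕ.+ n)))      ≈⟨ -‿cong (fromℕ-suc (suc (m ℕ.+ n))) ⟩
    - (1# + fromℕ (suc m ℕ.+ n))       ≈⟨ -‿cong (+-congˡ (×-homo-+ 1# (suc m) n)) ⟩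
    - (1# + (fromℕ (suc m) + fromℕ n)) ≈⟨ -‿cong (+-congˡ (+-comm _ _)) ⟩
    - (1# + (fromℕ n + fromℕ (suc m))) ≈⟨ -‿cong (+-assoc _ _ _) ⟨
    - (1# + fromℕ n + fromℕ (suc m))   ≈⟨ -‿cong (+-congʳ (fromℕ-suc n)) ⟨
    - (fromℕ (suc n) + fromℕ (suc m))  ≈⟨ -‿cong (+-comm _ _) ⟩
    - (fromℕ (suc m) + fromℕ (suc n))  ≈⟨ ⁻¹-∙-comm _ _ ⟨
    - fromℕ (suc m) - fromℕ (suc n)    ∎

  fromℤ-neg : ∀ i → fromℤ (ℤ.- i) ≈ - fromℤ i
  fromℤ-neg (+ zero)  = sym ε⁻¹≈ε
  fromℤ-neg (+ suc n) = refl
  fromℤ-neg -[1+ n ]  = sym (⁻¹-involutive _)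

  fromℤ-◃⁻ : ∀ n → fromℤ (Sign.- ℤ.◃ n) ≈ - fromℕ n
  fromℤ-◃⁻ zero    = sym ε⁻¹≈ε
  fromℤ-◃⁻ (suc n) = refl

  fromℤ-* : ∀ i j → fromℤ (i ℤ.* j) ≈ fromℤ i * fromℤ j
  fromℤ-* (+ m) (+ n) = begin
    fromℤ (Sign.+ ℤ.◃ m ℕ.* n) ≡⟨ ≡.cong fromℤ (ℤ.+◃n≡+n (m ℕ.* n)) ⟩
    fromℕ (m ℕ.* n)            ≈⟨ ×1-homo-* m n ⟩
    fromℕ m * fromℕ n          ∎
  fromℤ-* (+ m) -[1+ n ] = begin
    fromℤ (Sign.- ℤ.◃ m ℕ.* suc n) ≈⟨ fromℤ-◃⁻ (m ℕ.* suc n) ⟩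
    - fromℕ (m ℕ.* suc n)          ≈⟨ -‿cong (×1-homo-* m (suc n)) ⟩
    - (fromℕ m * fromℕ (suc n))    ≈⟨ -‿distribʳ-* _ _ ⟩
    fromℕ m * - fromℕ (suc n)      ∎
  fromℤ-* -[1+ m ] (+ n) = begin
    fromℤ (Sign.- ℤ.◃ suc m ℕ.* n) ≈⟨ fromℤ-◃⁻ (suc m ℕ.* n) ⟩
    - fromℕ (suc m ℕ.* n)          ≈⟨ -‿cong (×1-homo-* (suc m) n) ⟩
    - (fromℕ (suc m) * fromℕ n)    ≈⟨ -‿distribˡ-* _ _ ⟩
    - fromℕ (suc m) * fromℕ n      ∎
  fromℤ-* -[1+ m ] -[1+ n ] = begin
    fromℕ (suc m ℕ.* suc n)             ≈⟨ ×1-homo-* (suc m) (suc n) ⟩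
    fromℕ (suc m) * fromℕ (suc n)       ≈⟨ ⁻¹-involutive _ ⟨
    - - (fromℕ (suc m) * fromℕ (suc n)) ≈⟨ -‿cong (-‿distribʳ-* _ _) ⟩
    - (fromℕ (suc m) * - fromℕ (suc n)) ≈⟨ -‿distribˡ-* _ _ ⟩
    - fromℕ (suc m) * - fromℕ (suc n)   ∎

  fromℤ-morphism : ℤ.+-*-rawRing -Raw-AlmostCommutative⟶ fromCommutativeRing R
  fromℤ-morphism = record
    { ⟦_⟧    = fromℤ
    ; +-homo = fromℤ-+
    ; *-homo = fromℤ-*
    ; -‿homo = fromℤ-neg
    ; 0-homo = refl
    ; 1-homo = refl
    }

  -- The solver only asks for a sound test: equal integers have equal images, and nothing is claimed
  -- about distinct ones.
  fromℤ-≟ : ∀ i j → Maybe (fromℤ i ≈ fromℤ j)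
  fromℤ-≟ i j = Maybe.map (λ i≡j → reflexive (≡.cong fromℤ i≡j)) (dec⇒maybe (i ℤ.≟ j))

  open Algebra.Solver.Ring ℤ.+-*-rawRing (fromCommutativeRing R) fromℤ-morphism fromℤ-≟ public
    using (Polynomial; solve; con; _:+_; _:*_; _:-_; :-_; _:=_)

-- Arithmetic and inequalities in an ordered field

module OrderedField (ℝ : CompleteOrderedField) where
  open CompleteOrderedField ℝ
  open IntegerCoefficients commutativeRing public
  open AbelianGroupProperties +-abelianGroup using (x∙y⁻¹≈ε⇒x≈y; x≈y⇒x∙y⁻¹≈ε)
  open IsTotalOrder isTotalOrder public
    using (antisym; total)
    renaming
      ( reflexive to ≤-reflexive; refl to ≤-refl; trans to ≤-trans
      ; ≤-respˡ-≈ to ≤-respˡ; ≤-respʳ-≈ to ≤-respʳ )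

  -- Under the optimised multiples, `κ 1`, `κ 2` and `κ 3` evaluate to `1#`, `1# + 1#` and
  -- `1# + 1# + 1#` by computation, so literals in solver goals match `2#` and the bounds below with
  -- `refl`.
  κ : ∀ {n} → ℕ → Polynomial n
  κ k = con (+ k)

  infixl 6 _⊕_
  infixl 7 _⊗_

  _⊕_ : ∀ {x y} → 0# ≤ x → 0# ≤ y → 0# ≤ x + y
  _⊕_ {x} {y} 0≤x 0≤y = ≤-trans 0≤y (≤-respˡ (+-identityˡ y) (+-monoˡ-≤ y 0≤x))

  _⊗_ : ∀ {x y} → 0# ≤ x → 0# ≤ y → 0# ≤ x * y
  _⊗_ = *-nonneg

  gap : ∀ {x y} → x ≤ y → 0# ≤ y - x
  gap {x} x≤y = ≤-respˡ (-‿inverseʳ x) (+-monoˡ-≤ (- x) x≤y)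

  slack : ∀ {x y} → x ≈ y → 0# ≤ x - y
  slack x≈y = gap (≤-reflexive (sym x≈y))

  -- Inequalities are proved by certificates: y − x is written, by the ring
  -- solver, as a nonnegative combination of gaps of known inequalities.
  certify : ∀ {x y w} → 0# ≤ w → y - x ≈ w → x ≤ y
  certify {x} {y} 0≤w y-x≈w =
    ≤-respˡ (+-identityˡ x) (≤-respʳ (solve 2 (λ x y → y :- x :+ x := y) refl x y)
      (+-monoˡ-≤ x (≤-respʳ (sym y-x≈w) 0≤w)))

  -- The counterpart of `certify` for equations: x - y is written as a combination of residues of
  -- known equations. These vanish, so their coefficients may have either sign.
  equate : ∀ {x y w} → w ≈ 0# → x - y ≈ w → x ≈ y
  equate w≈0 x-y≈w = x∙y⁻¹≈ε⇒x≈y _ _ (trans x-y≈w w≈0)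

  residue : ∀ {x y} → x ≈ y → x - y ≈ 0#
  residue = x≈y⇒x∙y⁻¹≈ε

  infixl 6 _⊕₀_
  infixr 7 _⊗₀_

  _⊕₀_ : ∀ {x y} → x ≈ 0# → y ≈ 0# → x + y ≈ 0#
  x≈0 ⊕₀ y≈0 = trans (+-cong x≈0 y≈0) (+-identityˡ 0#)

  _⊗₀_ : ∀ x {y} → y ≈ 0# → x * y ≈ 0#
  x ⊗₀ y≈0 = trans (*-congˡ y≈0) (zeroʳ x)

  0≤x*x : ∀ x → 0# ≤ x * x
  0≤x*x x with total 0# x
  ... | inj₁ 0≤x = 0≤x ⊗ 0≤x
  ... | inj₂ x≤0 = ≤-respʳ (solve 1 (λ x → (κ 0 :- x) :* (κ 0 :- x) := x :* x) refl x)
                     (gap x≤0 ⊗ gap x≤0)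

  0≤1 : 0# ≤ 1#
  0≤1 = ≤-respʳ (*-identityˡ 1#) (0≤x*x 1#)

  0≤2 : 0# ≤ 2#
  0≤2 = 0≤1 ⊕ 0≤1

  0≤3 : 0# ≤ 1# + 1# + 1#
  0≤3 = 0≤2 ⊕ 0≤1

  1≤3 : 1# ≤ 1# + 1# + 1#
  1≤3 = certify 0≤2 (solve 0 (κ 3 :- κ 1 := κ 2) refl)

  0≤fromℕ : ∀ n → 0# ≤ fromℕ n
  0≤fromℕ zero    = ≤-refl
  0≤fromℕ (suc n) = ≤-respʳ (sym (fromℕ-suc n)) (0≤1 ⊕ 0≤fromℕ n)

  fromℕ-mono : ∀ {m n} → m ℕ.≤ n → fromℕ m ≤ fromℕ n
  fromℕ-mono {n = n} z≤n = 0≤fromℕ n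
  fromℕ-mono {suc m} {suc n} (s≤s m≤n) = certify (gap (fromℕ-mono m≤n))
    (trans (+-cong (fromℕ-suc n) (-‿cong (fromℕ-suc m)))
      (solve 2 (λ m n → (κ 1 :+ n) :- (κ 1 :+ m) := n :- m) refl (fromℕ m) (fromℕ n)))

  <⇒≱ : ∀ {x y} → x < y → ¬ (y ≤ x)
  <⇒≱ = ToStrict.<⇒≱ _≈_ _≤_ antisym

  ≰⇒> : ∀ {x y} → ¬ (x ≤ y) → y < x
  ≰⇒> = ToStrict.≰⇒> _≈_ _≤_ sym ≤-reflexive total

  ≱⇒≤ : ∀ {x y} → ¬ (y ≤ x) → x ≤ y
  ≱⇒≤ y≰x = proj₁ (≰⇒> y≰x)

  <-respˡ : ∀ {x y z} → x ≈ y → x < z → y < z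
  <-respˡ x≈y (x≤z , x≉z) = ≤-respˡ x≈y x≤z , λ y≈z → x≉z (trans x≈y y≈z)

  <-≤-trans : ∀ {x y z} → x < y → y ≤ z → x < z
  <-≤-trans x<y@(x≤y , _) y≤z =
    ≤-trans x≤y y≤z , λ x≈z → <⇒≱ x<y (≤-respʳ (sym x≈z) y≤z)

  ≤-<-trans : ∀ {x y z} → x ≤ y → y < z → x < z
  ≤-<-trans x≤y y<z@(y≤z , _) =
    ≤-trans x≤y y≤z , λ x≈z → <⇒≱ y<z (≤-respˡ x≈z x≤y)

  0<1 : 0# < 1#
  0<1 = 0≤1 , 0≉1

  1≤x⇒0<x : ∀ {x} → 1# ≤ x → 0# < x
  1≤x⇒0<x = <-≤-trans 0<1

  0<x⇒x≉0 : ∀ {x} → 0# < x → x ≉ 0#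
  0<x⇒x≉0 (_ , 0≉x) x≈0 = 0≉x (sym x≈0)

  <-+-nonneg : ∀ {x y} → 0# < x → 0# ≤ y → 0# < x + y
  <-+-nonneg {x} {y} 0<x 0≤y = <-≤-trans 0<x
    (certify 0≤y (solve 2 (λ x y → x :+ y :- x := y) refl x y))

  x*y≈0⇒y≈0 : ∀ {x y} → x ≉ 0# → x * y ≈ 0# → y ≈ 0#
  x*y≈0⇒y≈0 {x} {y} x≉0 x*y≈0 = begin
    y               ≈⟨ *-identityˡ y ⟨
    1# * y          ≈⟨ *-congʳ (*-inverseʳ x≉0) ⟨
    x * x ⁻¹ * y    ≈⟨ solve 3 (λ x i y → x :* i :* y := i :* (x :* y)) refl x (x ⁻¹) y ⟩
    x ⁻¹ * (x * y)  ≈⟨ *-congˡ x*y≈0 ⟩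
    x ⁻¹ * 0#       ≈⟨ zeroʳ _ ⟩
    0#              ∎
    where open Relation.Binary.Reasoning.Setoid setoid

  *-pos : ∀ {x y} → 0# < x → 0# < y → 0# < x * y
  *-pos 0<x@(0≤x , _) (0≤y , 0≉y) =
    0≤x ⊗ 0≤y , λ 0≈x*y → 0≉y (sym (x*y≈0⇒y≈0 (0<x⇒x≉0 0<x) (sym 0≈x*y)))

  gap-< : ∀ {x y} → x < y → 0# < y - x
  gap-< {x} {y} (x≤y , x≉y) = gap x≤y , λ 0≈y-x →
    x≉y (sym (x∙y⁻¹≈ε⇒x≈y y x (sym 0≈y-x)))

  certify-< : ∀ {x y w} → 0# < w → y - x ≈ w → x < y
  certify-< (0≤w , 0≉w) y-x≈w = certify 0≤w y-x≈w , λ x≈y →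
    0≉w (trans (sym (trans (+-congˡ (-‿cong x≈y)) (-‿inverseʳ _))) y-x≈w)

  square-mono : ∀ {x y} → 0# ≤ x → x ≤ y → x * x ≤ y * y
  square-mono {x} {y} 0≤x x≤y = certify (gap x≤y ⊗ gap x≤y ⊕ 0≤2 ⊗ 0≤x ⊗ gap x≤y)
    (solve 2 (λ x y → y :* y :- x :* x := (y :- x) :* (y :- x) :+ κ 2 :* x :* (y :- x)) refl x y)

  x*x<y*y⇒x≤y : ∀ {x y} → 0# ≤ y → x * x < y * y → x ≤ y
  x*x<y*y⇒x≤y {x} {y} 0≤y x²<y² with total x y
  ... | inj₁ x≤y = x≤y
  ... | inj₂ y≤x = ⊥-elim (<⇒≱ x²<y² (square-mono 0≤y y≤x))

  lower-bound : ∀ {x y} → 0# < x → 0# < y → ∃[ z ] 0# < z × z ≤ x × z ≤ y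
  lower-bound {x} {y} 0<x 0<y with total x y
  ... | inj₁ x≤y = x , 0<x , ≤-refl , x≤y
  ... | inj₂ y≤x = y , 0<y , y≤x , ≤-refl

  -- Stands in for a square root: z = min(x, 1) satisfies z² ≤ x.
  square-below : ∀ {x} → 0# < x → ∃[ z ] 0# < z × z * z ≤ x
  square-below {x} 0<x@(0≤x , _) with total x 1#
  ... | inj₁ x≤1 = x , 0<x , certify (0≤x ⊗ gap x≤1)
    (solve 1 (λ x → x :- x :* x := x :* (κ 1 :- x)) refl x)
  ... | inj₂ 1≤x = 1# , 0<1 , ≤-respˡ (sym (*-identityˡ 1#)) 1≤x

  -- No division occurs: if y ≤ x, then y - x is the sum of the nonnegative 2y - 2x and x - y.
  halve : ∀ {x y} → 2# * x ≤ 2# * y → x ≤ y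
  halve {x} {y} 2x≤2y with total x y
  ... | inj₁ x≤y = x≤y
  ... | inj₂ y≤x = certify (gap 2x≤2y ⊕ gap y≤x)
    (solve 2 (λ x y → y :- x := κ 2 :* y :- κ 2 :* x :+ (x :- y)) refl x y)

  -- Powers of two and their inverses

  1≤2^ : ∀ d → 1# ≤ 2# ^ d
  1≤2^ zero    = ≤-refl
  1≤2^ (suc d) = certify (0≤1 ⊕ 0≤2 ⊗ gap (1≤2^ d))
    (solve 1 (λ u → κ 2 :* u :- κ 1 := κ 1 :+ κ 2 :* (u :- κ 1)) refl (2# ^ d))

  fromℕ≤2^ : ∀ d → fromℕ d ≤ 2# ^ d
  fromℕ≤2^ zero    = 0≤1
  fromℕ≤2^ (suc d) = ≤-respˡ (sym (fromℕ-suc d)) (certify (gap (1≤2^ d) ⊕ gap (fromℕ≤2^ d))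
    (solve 2 (λ u n → κ 2 :* u :- (κ 1 :+ n) := u :- κ 1 :+ (u :- n)) refl (2# ^ d) (fromℕ d)))

  2^*2^- : ∀ d → 2# ^ d * 2^- d ≈ 1#
  2^*2^- d = *-inverseʳ (0<x⇒x≉0 (1≤x⇒0<x (1≤2^ d)))

  0<2^- : ∀ d → 0# < 2^- d
  0<2^- d with total 0# (2^- d)
  ... | inj₁ 0≤h = 0≤h , λ 0≈h →
    0≉1 (trans (sym (zeroʳ _)) (trans (*-congˡ 0≈h) (2^*2^- d)))
  -- With 2⁻ᵈ ≤ 0, the product 2ᵈ · 2⁻ᵈ = 1 would be at most 0.
  ... | inj₂ h≤0 = ⊥-elim (<⇒≱ 0<1 (certify (proj₁ (1≤x⇒0<x (1≤2^ d)) ⊗ gap h≤0 ⊕ slack (2^*2^- d))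
    (solve 2 (λ u h → κ 0 :- κ 1 := u :* (κ 0 :- h) :+ (u :* h :- κ 1)) refl (2# ^ d) (2^- d))))

  0≤2^- : ∀ d → 0# ≤ 2^- d
  0≤2^- d = proj₁ (0<2^- d)

  2^-0≈1 : 2^- 0 ≈ 1#
  2^-0≈1 = trans (sym (*-identityˡ _)) (2^*2^- 0)

  2^-d≈2*2^-1+d : ∀ d → 2^- d ≈ 2# * 2^- (suc d)
  2^-d≈2*2^-1+d d = begin
    2^- d                                     ≈⟨ *-identityʳ _ ⟨
    2^- d * 1#                                ≈⟨ *-congˡ (2^*2^- (suc d)) ⟨
    2^- d * (2# * 2# ^ d * 2^- (suc d))       ≈⟨ solve 3 (λ h u h′ → h :* (κ 2 :* u :* h′) := u :* h :* (κ 2 :* h′))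
                                                   refl (2^- d) (2# ^ d) (2^- (suc d)) ⟩
    2# ^ d * 2^- d * (2# * 2^- (suc d))       ≈⟨ *-congʳ (2^*2^- d) ⟩
    1# * (2# * 2^- (suc d))                   ≈⟨ *-identityˡ _ ⟩
    2# * 2^- (suc d)                          ∎
    where open Relation.Binary.Reasoning.Setoid setoid

-- The Archimedean property and passage to the limit

module Archimedean (em : ExcludedMiddle 0ℓ) (ℝ : CompleteOrderedField) where
  open CompleteOrderedField ℝ
  open OrderedField ℝ

  archimedean : ∀ x → ∃[ n ] x ≤ fromℕ n
  archimedean x with em {∃[ n ] x ≤ fromℕ n}
  ... | yes p = p
  ... | no ¬p = ⊥-elim (<⇒≱ u-1<u (least u-1-bound))
    where
    Naturals : Carrier → Set
    Naturals y = ∃[ n ] y ≈ fromℕ n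

    sup = supremum Naturals (0# , 0 , refl)
            (x , λ (n , y≈n) → ≤-respˡ (sym y≈n) (≱⇒≤ (λ x≤n → ¬p (n , x≤n))))
    u     = proj₁ sup
    bound = proj₁ (proj₂ sup)
    least = proj₂ (proj₂ sup)

    -- Each n + 1 is again a natural number, so n + 1 ≤ u. Hence u - 1 is a smaller upper bound,
    -- against the minimality of u.
    u-1-bound : UpperBound Naturals (u - 1#)
    u-1-bound (n , y≈n) = ≤-respˡ (sym y≈n) (certify (gap (bound (suc n , sym (fromℕ-suc n))))
      (solve 2 (λ u n → u :- κ 1 :- n := u :- (κ 1 :+ n)) refl u (fromℕ n)))

    u-1<u : u - 1# < u
    u-1<u = certify-< 0<1 (solve 1 (λ u → u :- (u :- κ 1) := κ 1) refl u)

  -- With N ≥ K / ε, every d ≥ N has 2ᵈ ≥ d ≥ N ≥ K / ε; multiplying by ε · 2⁻ᵈ gives the claim,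
  -- whatever the sign of K.
  2^-small : ∀ {ε} K → 0# < ε → ∃[ N ] (∀ {d} → N ℕ.≤ d → 2^- d * K ≤ ε)
  2^-small {ε} K 0<ε@(0≤ε , _) with archimedean (K * ε ⁻¹)
  ... | N , K/ε≤N = N , λ {d} N≤d → certify
    (0≤2^- d ⊗ (0≤ε ⊗ gap (≤-trans K/ε≤N (≤-trans (fromℕ-mono N≤d) (fromℕ≤2^ d))) ⊕ slack K*ε*ε⁻¹≈K)
      ⊕ slack (ε*2^-*2^≈ε d))
    (solve 5 (λ ε K i u h → ε :- h :* K
                := h :* (ε :* (u :- K :* i) :+ (K :* ε :* i :- K)) :+ (ε :- ε :* (u :* h)))
      refl ε K (ε ⁻¹) (2# ^ d) (2^- d))
    where
    K*ε*ε⁻¹≈K : K * ε * ε ⁻¹ ≈ K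
    K*ε*ε⁻¹≈K = trans (*-assoc _ _ _) (trans (*-congˡ (*-inverseʳ (0<x⇒x≉0 0<ε))) (*-identityʳ K))
    ε*2^-*2^≈ε : ∀ d → ε ≈ ε * (2# ^ d * 2^- d)
    ε*2^-*2^≈ε d = sym (trans (*-congˡ (2^*2^- d)) (*-identityʳ ε))

  ≤-up-to-ε : ∀ {x y} K → (∀ ε → 0# < ε → x ≤ y + K * ε) → x ≤ y
  ≤-up-to-ε {x} {y} K x≤y+Kε with em {x ≤ y}
  ... | yes x≤y = x≤y
  ... | no  x≰y = ⊥-elim (<⇒≱ (0<2^- N) (certify (gap (x≤y+Kε h (0<2^- N)) ⊕ gap (small ℕ.≤-refl))
      (solve 4 (λ x y K h → κ 0 :- h := y :+ K :* h :- x :+ (x :- y :- h :* (κ 1 :+ K))) refl x y K h)))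
    where
    -- The summand `1#` leaves room for a contradiction: (1 + K) h ≤ x - y and x ≤ y + K h together
    -- force h ≤ 0.
    small′ = 2^-small (1# + K) (gap-< (≰⇒> x≰y))
    N      = proj₁ small′
    small  = proj₂ small′
    h      = 2^- N

-- Distances and isolation from finitely many nodes

module Metric (em : ExcludedMiddle 0ℓ) (ℝ : CompleteOrderedField) where
  open CompleteOrderedField ℝ
  open OrderedField ℝ
  open Plane ℝ
  open Tree ℝ

  dist²-cong : ∀ {p q r} → q ≈ₚ r → dist² p q ≈ dist² p r
  dist²-cong (x≈ , y≈) = +-cong (*-cong δx δx) (*-cong δy δy)
    where
    δx = +-congˡ (-‿cong x≈)
    δy = +-congˡ (-‿cong y≈)

  x*x≈0⇒x≈0 : ∀ {x} → x * x ≈ 0# → x ≈ 0#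
  x*x≈0⇒x≈0 {x} x²≈0 with em {x ≈ 0#}
  ... | yes x≈0 = x≈0
  ... | no  x≉0 = x*y≈0⇒y≈0 x≉0 x²≈0

  x²+y²≈0⇒x≈0 : ∀ {x y} → x * x + y * y ≈ 0# → x ≈ 0#
  x²+y²≈0⇒x≈0 {x} {y} x²+y²≈0 = x*x≈0⇒x≈0 (antisym
    (certify (slack (sym x²+y²≈0) ⊕ 0≤x*x y)
      (solve 2 (λ x y → κ 0 :- x :* x := κ 0 :- (x :* x :+ y :* y) :+ y :* y) refl x y))
    (0≤x*x x))

  0<dist² : ∀ {p q} → ¬ (q ≈ₚ p) → 0# < dist² p q
  0<dist² {a , b} {x , y} q≉p = 0≤x*x (a - x) ⊕ 0≤x*x (b - y) , λ 0≈d → q≉p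
    ( sym (equate (x²+y²≈0⇒x≈0 (sym 0≈d)) refl)
    , sym (equate (x²+y²≈0⇒x≈0 (trans (+-comm _ _) (sym 0≈d))) refl) )

  -- A node located at `p` itself is exempt, in accordance with the condition `¬ (q ≈ₚ p)` in
  -- `AccumulationPoint`. Thus every node, and by taking minima every finite list of nodes, admits a
  -- positive radius.
  Isolates : Carrier → Point → Node → Set
  Isolates ε p n = ¬ (location n ≈ₚ p) → ε * ε ≤ dist² p (location n)

  isolates-anti : ∀ {ε ε′ p n} → 0# ≤ ε → ε ≤ ε′ → Isolates ε′ p n → Isolates ε p n
  isolates-anti 0≤ε ε≤ε′ iso n≉p = ≤-trans (square-mono 0≤ε ε≤ε′) (iso n≉p)

  isolating-node : ∀ p n → ∃[ ε ] 0# < ε × Isolates ε p n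
  isolating-node p n = by-cases em
    where
    by-cases : Dec (location n ≈ₚ p) → ∃[ ε ] 0# < ε × Isolates ε p n
    by-cases (yes n≈p) = 1# , 0<1 , λ n≉p → ⊥-elim (n≉p n≈p)
    by-cases (no  n≉p) = let ε , 0<ε , ε²≤d = square-below (0<dist² n≉p) in ε , 0<ε , λ _ → ε²≤d

  isolating : ∀ p ns → ∃[ ε ] 0# < ε × (∀ {n} → n ∈ₗ ns → Isolates ε p n)
  isolating p []       = 1# , 0<1 , λ ()
  isolating p (n ∷ ns) =
    let ε₁ , 0<ε₁ , iso₁ = isolating-node p n
        ε₂ , 0<ε₂ , iso₂ = isolating p ns
        ε , 0<ε , ε≤ε₁ , ε≤ε₂ = lower-bound 0<ε₁ 0<ε₂
    in ε , 0<ε , λ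
      { {m} (here ≡.refl) → isolates-anti {n = m} (proj₁ 0<ε) ε≤ε₁ iso₁
      ; {m} (there m∈ns) → isolates-anti {n = m} (proj₁ 0<ε) ε≤ε₂ (iso₂ m∈ns) }

  ½ : Carrier
  ½ = 2# ⁻¹

  2*½≈1 : 2# * ½ ≈ 1#
  2*½≈1 = *-inverseʳ (0<x⇒x≉0 (<-+-nonneg 0<1 0≤1))

-- The target segment as convex hull and as graph

module Segment (em : ExcludedMiddle 0ℓ) (ℝ : CompleteOrderedField)
  (s₀ t₀ : CompleteOrderedField.Carrier ℝ) where
  open CompleteOrderedField ℝ
  open OrderedField ℝ
  open Metric em ℝ
  open Plane ℝ

  segment-ordinate : Carrier → Carrier
  segment-ordinate x = (s₀ + t₀) / 2# + (t₀ - s₀) / 2# * x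

  -- Doubling clears the division by 2, so that points on the segment are described by a polynomial
  -- equation, of the same shape as the midpoint equation of the nodes.
  2*segment-ordinate : ∀ x → 2# * segment-ordinate x ≈ s₀ + t₀ + (t₀ - s₀) * x
  2*segment-ordinate x = equate ((s₀ + t₀ + (t₀ - s₀) * x) ⊗₀ residue 2*½≈1)
    (solve 4 (λ s t i x → κ 2 :* ((s :+ t) :* i :+ (t :- s) :* i :* x) :- (s :+ t :+ (t :- s) :* x)
                := (s :+ t :+ (t :- s) :* x) :* (κ 2 :* i :- κ 1)) refl s₀ t₀ ½ x)

  segment-ordinate-unique : ∀ {x y} → 2# * y ≈ s₀ + t₀ + (t₀ - s₀) * x → y ≈ segment-ordinate x
  segment-ordinate-unique {x} {y} eq = equate (½ ⊗₀ residue eq ⊕₀ (- y) ⊗₀ residue 2*½≈1)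
    (solve 5 (λ s t i x y → y :- ((s :+ t) :* i :+ (t :- s) :* i :* x)
                := i :* (κ 2 :* y :- (s :+ t :+ (t :- s) :* x)) :+ (:- y) :* (κ 2 :* i :- κ 1))
      refl s₀ t₀ ½ x y)

  segment≐graph : ClosedSegment (- 1# , s₀) (1# , t₀) ≐ SegmentGraph s₀ t₀
  segment≐graph = to , from
    where
    to : ∀ {p} → ClosedSegment (- 1# , s₀) (1# , t₀) p → SegmentGraph s₀ t₀ p
    to {a , b} (r , 0≤r , r≤1 , a≈ , b≈) = a
      , certify (0≤2 ⊗ 0≤r ⊕ slack a≈)
          (solve 2 (λ a r → a :- :- κ 1 := κ 2 :* r :+ (a :- ((κ 1 :- r) :* :- κ 1 :+ r :* κ 1))) refl a r)
      , certify (0≤2 ⊗ gap r≤1 ⊕ slack (sym a≈))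
          (solve 2 (λ a r → κ 1 :- a := κ 2 :* (κ 1 :- r) :+ ((κ 1 :- r) :* :- κ 1 :+ r :* κ 1 :- a)) refl a r)
      , refl
      , segment-ordinate-unique (equate (2# ⊗₀ residue b≈ ⊕₀ (- (t₀ - s₀)) ⊗₀ residue a≈)
          (solve 5 (λ s t a b r → κ 2 :* b :- (s :+ t :+ (t :- s) :* a)
              := κ 2 :* (b :- ((κ 1 :- r) :* s :+ r :* t))
                 :+ (:- (t :- s)) :* (a :- ((κ 1 :- r) :* :- κ 1 :+ r :* κ 1)))
            refl s₀ t₀ a b r))

    from : ∀ {p} → SegmentGraph s₀ t₀ p → ClosedSegment (- 1# , s₀) (1# , t₀) p
    from {a , b} (x , -1≤x , x≤1 , a≈x , b≈) = r
      , ≤-respʳ (*-comm ½ (1# + x)) (0≤½ ⊗ ≤-respʳ (solve 1 (λ x → x :- :- κ 1 := κ 1 :+ x) refl x) (gap -1≤x))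
      , certify (0≤½ ⊗ gap x≤1 ⊕ slack (sym 2*½≈1))
          (solve 2 (λ x i → κ 1 :- (κ 1 :+ x) :* i := i :* (κ 1 :- x) :+ (κ 1 :- κ 2 :* i)) refl x ½)
      , trans a≈x (equate ((- (1# + x)) ⊗₀ residue 2*½≈1)
          (solve 2 (λ x i → x :- ((κ 1 :- (κ 1 :+ x) :* i) :* :- κ 1 :+ (κ 1 :+ x) :* i :* κ 1)
              := (:- (κ 1 :+ x)) :* (κ 2 :* i :- κ 1)) refl x ½))
      , trans b≈ (equate (s₀ ⊗₀ residue 2*½≈1)
          (solve 4 (λ s t x i → ((s :+ t) :* i :+ (t :- s) :* i :* x)
              :- ((κ 1 :- (κ 1 :+ x) :* i) :* s :+ (κ 1 :+ x) :* i :* t)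
              := s :* (κ 2 :* i :- κ 1)) refl s₀ t₀ x ½))
      where
      -- The solution of (1 - r)(-1) + r = x.
      r = (1# + x) * ½
      0≤½ : 0# ≤ ½
      -- One half is twice its own square, and squares are nonnegative.
      0≤½ = ≤-respʳ (trans (sym (*-assoc _ _ _)) (trans (*-congʳ 2*½≈1) (*-identityˡ ½))) (0≤2 ⊗ 0≤x*x ½)

-- Invariants of the nodes

module Construction (em : ExcludedMiddle 0ℓ) (ℝ : CompleteOrderedField)
  (s₀ t₀ : CompleteOrderedField.Carrier ℝ)
  (1≤s₀ : CompleteOrderedField._≤_ ℝ (CompleteOrderedField.1# ℝ) s₀)
  (1≤t₀ : CompleteOrderedField._≤_ ℝ (CompleteOrderedField.1# ℝ) t₀) where
  open CompleteOrderedField ℝ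
  open OrderedField ℝ
  open Archimedean em ℝ
  open Plane ℝ
  open Tree ℝ
  open Metric em ℝ
  open Segment em ℝ s₀ t₀

  0≤s₀ : 0# ≤ s₀
  0≤s₀ = ≤-trans 0≤1 1≤s₀

  0≤t₀ : 0# ≤ t₀
  0≤t₀ = ≤-trans 0≤1 1≤t₀

  -- M: a split node has s + t ≤ 4 + σ, and splitting at most triples s + t.
  σ δ M : Carrier
  σ = s₀ + t₀
  δ = t₀ - s₀
  M = fromℕ 3 * (fromℕ 4 + σ)

  0≤σ : 0# ≤ σ
  0≤σ = 0≤s₀ ⊕ 0≤t₀

  0≤M : 0# ≤ M
  0≤M = 0≤3 ⊗ (0≤fromℕ 4 ⊕ 0≤σ)

  -- Given the slope, the midpoint equation and the two abscissa bounds say that the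
  -- segment aimed at is part of the target segment.
  record Invariant (x y : Carrier) (d : ℕ) (s t : Carrier) : Set where
    field
      1≤s      : 1# ≤ s
      1≤t      : 1# ≤ t
      slope    : t - s ≈ δ
      midpoint : 2# * y + 2^- d * (s + t) ≈ σ + δ * x
      left     : 2^- d ≤ 1# + x
      right    : 2^- d ≤ 1# - x
      s+t≤M    : s + t ≤ M

    0≤s : 0# ≤ s
    0≤s = ≤-trans 0≤1 1≤s

    0≤t : 0# ≤ t
    0≤t = ≤-trans 0≤1 1≤t

  NodeInvariant : Node → Set
  NodeInvariant (node (x , y) d s t) = Invariant x y d s t

  root-invariant : NodeInvariant (root s₀ t₀)
  root-invariant = record
    { 1≤s      = 1≤s₀
    ; 1≤t      = 1≤t₀
    ; slope    = refl
    ; midpoint = equate (σ ⊗₀ residue 2^-0≈1)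
        (solve 3 (λ s t h → κ 2 :* κ 0 :+ h :* (s :+ t) :- (s :+ t :+ (t :- s) :* κ 0)
                    := (s :+ t) :* (h :- κ 1)) refl s₀ t₀ (2^- 0))
    ; left     = certify (slack (sym 2^-0≈1)) (solve 1 (λ h → κ 1 :+ κ 0 :- h := κ 1 :- h) refl (2^- 0))
    ; right    = certify (slack (sym 2^-0≈1)) (solve 1 (λ h → κ 1 :- κ 0 :- h := κ 1 :- h) refl (2^- 0))
    ; s+t≤M    = certify (0≤fromℕ 12 ⊕ 0≤2 ⊗ 0≤σ)
        (solve 2 (λ s t → κ 3 :* (κ 4 :+ (s :+ t)) :- (s :+ t) := κ 12 :+ κ 2 :* (s :+ t)) refl s₀ t₀)
    }

  -- By the slope, s < 2 gives s + t = 2s + (t₀ - s₀) ≤ 4 + t₀, and symmetrically t < 2 gives s + t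
  -- ≤ 4 + s₀.
  split-s+t≤ : ∀ {s t} → t - s ≈ δ → s < 2# ⊎ t < 2# → s + t ≤ fromℕ 4 + σ
  split-s+t≤ {s} {t} slope (inj₁ (s≤2 , _)) =
    certify (0≤2 ⊗ gap s≤2 ⊕ 0≤2 ⊗ 0≤s₀ ⊕ slack (sym slope))
      (solve 4 (λ s t s₀ t₀ → κ 4 :+ (s₀ :+ t₀) :- (s :+ t)
          := κ 2 :* (κ 2 :- s) :+ κ 2 :* s₀ :+ (t₀ :- s₀ :- (t :- s))) refl s t s₀ t₀)
  split-s+t≤ {s} {t} slope (inj₂ (t≤2 , _)) =
    certify (0≤2 ⊗ gap t≤2 ⊕ 0≤2 ⊗ 0≤t₀ ⊕ slack slope)
      (solve 4 (λ s t s₀ t₀ → κ 4 :+ (s₀ :+ t₀) :- (s :+ t)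
          := κ 2 :* (κ 2 :- t) :+ κ 2 :* t₀ :+ (t :- s :- (t₀ :- s₀))) refl s t s₀ t₀)

  delay-invariant : ∀ {x y d s t} → 2# ≤ s → 2# ≤ t → Invariant x y d s t →
                    Invariant x (y + 2^- d) d (s - 1#) (t - 1#)
  delay-invariant {x} {y} {d} {s} {t} 2≤s 2≤t inv = record
    { 1≤s      = certify (gap 2≤s) (solve 1 (λ s → s :- κ 1 :- κ 1 := s :- κ 2) refl s)
    ; 1≤t      = certify (gap 2≤t) (solve 1 (λ s → s :- κ 1 :- κ 1 := s :- κ 2) refl t)
    ; slope    = trans (solve 2 (λ s t → t :- κ 1 :- (s :- κ 1) := t :- s) refl s t) slope
    ; midpoint = trans (solve 4 (λ y h s t → κ 2 :* (y :+ h) :+ h :* (s :- κ 1 :+ (t :- κ 1))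
                                   := κ 2 :* y :+ h :* (s :+ t)) refl y (2^- d) s t) midpoint
    ; left     = left
    ; right    = right
    ; s+t≤M    = certify (gap s+t≤M ⊕ 0≤2)
        (solve 3 (λ s t m → m :- (s :- κ 1 :+ (t :- κ 1)) := m :- (s :+ t) :+ κ 2) refl s t M)
    }
    where open Invariant inv

  left-invariant : ∀ {x y d s t} → s < 2# ⊎ t < 2# → Invariant x y d s t →
                   Invariant (x - 2^- (suc d)) (y + 2^- (suc d)) (suc d) (2# * s - 1#) (s + t - 1#)
  left-invariant {x} {y} {d} {s} {t} split inv = record
    { 1≤s      = certify (0≤2 ⊗ gap 1≤s) (solve 1 (λ s → κ 2 :* s :- κ 1 :- κ 1 := κ 2 :* (s :- κ 1)) refl s)
    ; 1≤t      = certify (gap 1≤s ⊕ gap 1≤t)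
        (solve 2 (λ s t → s :+ t :- κ 1 :- κ 1 := s :- κ 1 :+ (t :- κ 1)) refl s t)
    ; slope    = trans (solve 2 (λ s t → s :+ t :- κ 1 :- (κ 2 :* s :- κ 1) := t :- s) refl s t) slope
    -- The climb 2h′ cancels the two units subtracted from the parameters. Since 3s + t = 2(s + t) -
    -- (t - s) and h = 2h′, the left side drops by h′δ, as the right side does when x moves to x -
    -- h′.
    ; midpoint = equate (residue midpoint ⊕₀ (- (s + t)) ⊗₀ residue (2^-d≈2*2^-1+d d) ⊕₀ (- h′) ⊗₀ residue slope)
        (solve 8 (λ x y h h′ s t σ δ →
            κ 2 :* (y :+ h′) :+ h′ :* (κ 2 :* s :- κ 1 :+ (s :+ t :- κ 1)) :- (σ :+ δ :* (x :- h′))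
            := κ 2 :* y :+ h :* (s :+ t) :- (σ :+ δ :* x) :+ (:- (s :+ t)) :* (h :- κ 2 :* h′)
               :+ (:- h′) :* (t :- s :- δ))
          refl x y (2^- d) h′ s t σ δ)
    ; left     = certify (gap left ⊕ slack (2^-d≈2*2^-1+d d))
        (solve 3 (λ x h h′ → κ 1 :+ (x :- h′) :- h′ := κ 1 :+ x :- h :+ (h :- κ 2 :* h′)) refl x (2^- d) h′)
    ; right    = certify (gap right ⊕ 0≤2^- d)
        (solve 3 (λ x h h′ → κ 1 :- (x :- h′) :- h′ := κ 1 :- x :- h :+ h) refl x (2^- d) h′)
    ; s+t≤M    = certify (0≤3 ⊗ gap (split-s+t≤ slope split) ⊕ 0≤2 ⊗ 0≤t ⊕ 0≤2)
        (solve 3 (λ s t m → κ 3 :* m :- (κ 2 :* s :- κ 1 :+ (s :+ t :- κ 1))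
                    := κ 3 :* (m :- (s :+ t)) :+ κ 2 :* t :+ κ 2) refl s t (fromℕ 4 + σ))
    }
    where
    open Invariant inv
    h′ = 2^- (suc d)

  right-invariant : ∀ {x y d s t} → s < 2# ⊎ t < 2# → Invariant x y d s t →
                    Invariant (x + 2^- (suc d)) (y + 2^- (suc d)) (suc d) (s + t - 1#) (2# * t - 1#)
  right-invariant {x} {y} {d} {s} {t} split inv = record
    { 1≤s      = certify (gap 1≤s ⊕ gap 1≤t)
        (solve 2 (λ s t → s :+ t :- κ 1 :- κ 1 := s :- κ 1 :+ (t :- κ 1)) refl s t)
    ; 1≤t      = certify (0≤2 ⊗ gap 1≤t) (solve 1 (λ s → κ 2 :* s :- κ 1 :- κ 1 := κ 2 :* (s :- κ 1)) refl t)
    ; slope    = trans (solve 2 (λ s t → κ 2 :* t :- κ 1 :- (s :+ t :- κ 1) := t :- s) refl s t) slope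
    ; midpoint = equate (residue midpoint ⊕₀ (- (s + t)) ⊗₀ residue (2^-d≈2*2^-1+d d) ⊕₀ h′ ⊗₀ residue slope)
        (solve 8 (λ x y h h′ s t σ δ →
            κ 2 :* (y :+ h′) :+ h′ :* (s :+ t :- κ 1 :+ (κ 2 :* t :- κ 1)) :- (σ :+ δ :* (x :+ h′))
            := κ 2 :* y :+ h :* (s :+ t) :- (σ :+ δ :* x) :+ (:- (s :+ t)) :* (h :- κ 2 :* h′)
               :+ h′ :* (t :- s :- δ))
          refl x y (2^- d) h′ s t σ δ)
    ; left     = certify (gap left ⊕ 0≤2^- d)
        (solve 3 (λ x h h′ → κ 1 :+ (x :+ h′) :- h′ := κ 1 :+ x :- h :+ h) refl x (2^- d) h′)
    ; right    = certify (gap right ⊕ slack (2^-d≈2*2^-1+d d))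
        (solve 3 (λ x h h′ → κ 1 :- (x :+ h′) :- h′ := κ 1 :- x :- h :+ (h :- κ 2 :* h′)) refl x (2^- d) h′)
    ; s+t≤M    = certify (0≤3 ⊗ gap (split-s+t≤ slope split) ⊕ 0≤2 ⊗ 0≤s ⊕ 0≤2)
        (solve 3 (λ s t m → κ 3 :* m :- (s :+ t :- κ 1 :+ (κ 2 :* t :- κ 1))
                    := κ 3 :* (m :- (s :+ t)) :+ κ 2 :* s :+ κ 2) refl s t (fromℕ 4 + σ))
    }
    where
    open Invariant inv
    h′ = 2^- (suc d)

  invariant : ∀ {n} → n ∈ 𝒯 s₀ t₀ → NodeInvariant n
  invariant root∈                     = root-invariant
  invariant (delay∈ n∈𝒯 (2≤s , 2≤t)) = delay-invariant 2≤s 2≤t (invariant n∈𝒯)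
  invariant (left∈ n∈𝒯 split)        = left-invariant split (invariant n∈𝒯)
  invariant (right∈ n∈𝒯 split)       = right-invariant split (invariant n∈𝒯)

  -- Finitely many nodes of each depth

  children : Node → List Node
  children n = delayChild n ∷ leftChild n ∷ rightChild n ∷ []

  -- A superset of the nodes with k ancestors: no child is discarded.
  level : ℕ → List Node
  level zero    = root s₀ t₀ ∷ []
  level (suc k) = concatMap children (level k)

  ∈-level-suc : ∀ {n m} k → n ∈ₗ level k → m ∈ₗ children n → m ∈ₗ level (suc k)
  ∈-level-suc k n∈level m∈children = ∈-concatMap⁺ children (Any.map (λ { ≡.refl → m∈children }) n∈level)

  -- A natural number above `M`, hence above the parameter s of every node: a budget for consecutive
  -- delays.
  C : ℕ
  C = proj₁ (archimedean M)

  s≤C : ∀ {x y d s t} → Invariant x y d s t → s ≤ fromℕ C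
  s≤C {s = s} {t} inv = ≤-trans (certify (0≤t ⊕ gap s+t≤M)
    (solve 3 (λ s t m → m :- s := t :+ (m :- (s :+ t))) refl s t M)) (proj₂ (archimedean M))
    where open Invariant inv

  -- A potential argument, with k the level and j the remaining budget. A delay trades one unit of j
  -- for one level; a split resets j to `C`, which is paid for by the extra `C` that the greater
  -- depth adds on the right.
  LevelBound : Node → Set
  LevelBound n = ∃[ k ] ∃[ j ] n ∈ₗ level k × Node.s n ≤ fromℕ j × k ℕ.+ j ℕ.≤ suc (depth n) ℕ.* C

  split-levelBound : ∀ {n} m → LevelBound n → 1# ≤ Node.s n → m ∈ₗ children n →
                     depth m ≡.≡ suc (depth n) → Node.s m ≤ fromℕ C → LevelBound m
  -- Since 1 ≤ s, the budget is positive; its last unit pays for the level added by the split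
  -- itself.
  split-levelBound m (k , zero  , _  , s≤0 , _) 1≤s _ _ _ = ⊥-elim (<⇒≱ 0<1 (≤-trans 1≤s s≤0))
  split-levelBound m (k , suc j , n∈ , s≤j , k+j≤) 1≤s m∈ ≡.refl s≤C =
    suc k , C , ∈-level-suc k n∈ m∈ , s≤C ,
    ℕ.≤-trans (ℕ.≤-reflexive (ℕ.+-comm (suc k) C))
      (ℕ.+-monoʳ-≤ C (ℕ.≤-trans (ℕ.≤-trans (s≤s (ℕ.m≤m+n k j)) (ℕ.≤-reflexive (≡.sym (ℕ.+-suc k j)))) k+j≤))

  delay-levelBound : ∀ {x y d s t} → 2# ≤ s → LevelBound (node (x , y) d s t) →
                     LevelBound (delayChild (node (x , y) d s t))
  delay-levelBound 2≤s (k , zero  , _  , s≤0 , _) = ⊥-elim (<⇒≱ (<-+-nonneg 0<1 0≤1) (≤-trans 2≤s s≤0))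
  delay-levelBound {s = s} 2≤s (k , suc j , n∈ , s≤j , k+j≤) =
    suc k , j , ∈-level-suc k n∈ (here ≡.refl)
    , certify (gap (≤-respʳ (fromℕ-suc j) s≤j))
        (solve 2 (λ s j → j :- (s :- κ 1) := κ 1 :+ j :- s) refl s (fromℕ j))
    , ℕ.≤-trans (ℕ.≤-reflexive (≡.sym (ℕ.+-suc k j))) k+j≤

  -- A delay node lowers s by 1 and s ≤ C, so each depth accounts for at most C levels.
  levelBound : ∀ {n} → n ∈ 𝒯 s₀ t₀ → LevelBound n
  levelBound root∈ =
    0 , C , here ≡.refl , s≤C root-invariant , ℕ.≤-reflexive (≡.sym (ℕ.+-identityʳ C))
  levelBound (delay∈ n∈𝒯 (2≤s , _)) = delay-levelBound 2≤s (levelBound n∈𝒯)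
  levelBound n∈@(left∈ {n} n∈𝒯 _) =
    split-levelBound (leftChild n) (levelBound n∈𝒯) (Invariant.1≤s (invariant n∈𝒯))
      (there (here ≡.refl)) ≡.refl (s≤C (invariant n∈))
  levelBound n∈@(right∈ {n} n∈𝒯 _) =
    split-levelBound (rightChild n) (levelBound n∈𝒯) (Invariant.1≤s (invariant n∈𝒯))
      (there (there (here ≡.refl))) ≡.refl (s≤C (invariant n∈))

  shallowNodes : ℕ → List Node
  shallowNodes N = concatMap level (upTo (suc (N ℕ.* C)))

  -- From depth + 1 ≤ N follows k ≤ k + j ≤ N · C, so the levels 0 to N · C suffice.
  ∈-shallowNodes : ∀ {n N} → n ∈ 𝒯 s₀ t₀ → depth n ℕ.< N → n ∈ₗ shallowNodes N
  ∈-shallowNodes n∈𝒯 d<N =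
    let k , j , n∈ , _ , k+j≤ = levelBound n∈𝒯
    in ∈-concatMap⁺ level (Any.map (λ { ≡.refl → n∈ })
         (∈-upTo⁺ (s≤s (ℕ.≤-trans (ℕ.m≤m+n k j) (ℕ.≤-trans k+j≤ (ℕ.*-monoˡ-≤ C d<N))))))

  -- Accumulation points lie on the segment

  -- The finitely many nodes of depth below N stay at distance at least some ε₁ from p unless they
  -- are at p. A location other than p and closer than ε₁ therefore belongs to a deep node.
  deep-approximation : ∀ {p} → AccumulationPoint (Locations s₀ t₀) p → ∀ {ε} → 0# < ε → ∀ N →
    ∃[ n ] n ∈ 𝒯 s₀ t₀ × N ℕ.≤ depth n × dist² p (location n) < ε * ε
  deep-approximation {p} acc 0<ε N =
    let ε₁ , 0<ε₁ , isolated = isolating p (shallowNodes N)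
        ε₂ , 0<ε₂ , ε₂≤ε , ε₂≤ε₁ = lower-bound 0<ε 0<ε₁
        q , (n , n∈𝒯 , x≈ , y≈) , q≉p , dist< = acc ε₂ 0<ε₂
        dist′< = <-respˡ (dist²-cong {p} (x≈ , y≈)) dist<
        deep = ℕ.≮⇒≥ λ d<N → <⇒≱ dist′<
          (isolates-anti {n = n} (proj₁ 0<ε₂) ε₂≤ε₁ (isolated (∈-shallowNodes n∈𝒯 d<N))
            (λ (x≈′ , y≈′) → q≉p (trans x≈ x≈′ , trans y≈ y≈′)))
    in n , n∈𝒯 , deep , <-≤-trans dist′< (square-mono (proj₁ 0<ε₂) ε₂≤ε)

  -- What the limit argument takes from a deep node near (a , b). By `midpoint`, h (s + t) is twice
  -- the height of the target segment above the node.
  record Approximation (a b ε : Carrier) : Set where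
    field
      x y h s t : Carrier
      -1≤x      : - 1# ≤ x
      x≤1       : x ≤ 1#
      0≤h*[s+t] : 0# ≤ h * (s + t)
      h*[s+t]≤ε : h * (s + t) ≤ ε
      midpoint  : 2# * y + h * (s + t) ≈ σ + δ * x
      a-x≤ε     : a - x ≤ ε
      x-a≤ε     : x - a ≤ ε
      b-y≤ε     : b - y ≤ ε
      y-b≤ε     : y - b ≤ ε

  node-approximation : ∀ {a b ε x y d s t} → 0# ≤ ε → Invariant x y d s t → 2^- d * M ≤ ε →
                       dist² (a , b) (x , y) < ε * ε → Approximation a b ε
  node-approximation {a} {b} {ε} {x} {y} {d} {s} {t} 0≤ε inv hM≤ε dist< = record
    { x         = x
    ; y         = y
    ; h         = 2^- d
    ; s         = s
    ; t         = t
    ; -1≤x      = certify (gap left ⊕ 0≤2^- d) (solve 2 (λ x h → x :- :- κ 1 := κ 1 :+ x :- h :+ h) refl x (2^- d))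
    ; x≤1       = certify (gap right ⊕ 0≤2^- d) (solve 2 (λ x h → κ 1 :- x := κ 1 :- x :- h :+ h) refl x (2^- d))
    ; 0≤h*[s+t] = 0≤2^- d ⊗ (0≤s ⊕ 0≤t)
    ; h*[s+t]≤ε = certify (gap hM≤ε ⊕ 0≤2^- d ⊗ gap s+t≤M)
        (solve 5 (λ ε h s t m → ε :- h :* (s :+ t) := ε :- h :* m :+ h :* (m :- (s :+ t))) refl ε (2^- d) s t M)
    ; midpoint  = midpoint
    ; a-x≤ε     = x*x<y*y⇒x≤y 0≤ε x-close
    ; x-a≤ε     = x*x<y*y⇒x≤y 0≤ε (<-respˡ (square-flip a x) x-close)
    ; b-y≤ε     = x*x<y*y⇒x≤y 0≤ε y-close
    ; y-b≤ε     = x*x<y*y⇒x≤y 0≤ε (<-respˡ (square-flip b y) y-close)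
    }
    where
    open Invariant inv
    square-flip : ∀ u v → (u - v) * (u - v) ≈ (v - u) * (v - u)
    square-flip = solve 2 (λ u v → (u :- v) :* (u :- v) := (v :- u) :* (v :- u)) refl
    x-close : (a - x) * (a - x) < ε * ε
    x-close = ≤-<-trans (certify (0≤x*x (b - y))
      (solve 2 (λ u v → u :* u :+ v :* v :- u :* u := v :* v) refl (a - x) (b - y))) dist<
    y-close : (b - y) * (b - y) < ε * ε
    y-close = ≤-<-trans (certify (0≤x*x (a - x))
      (solve 2 (λ u v → u :* u :+ v :* v :- v :* v := u :* u) refl (a - x) (b - y))) dist<

  approximation : ∀ {a b} → AccumulationPoint (Locations s₀ t₀) (a , b) → ∀ ε → 0# < ε → Approximation a b ε
  approximation acc ε 0<ε =
    let N , small = 2^-small M 0<ε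
        n , n∈𝒯 , N≤d , dist< = deep-approximation acc 0<ε N
    in node-approximation (proj₁ 0<ε) (invariant n∈𝒯) (small N≤d) dist<

  accumulation⊆graph : ∀ {p} → AccumulationPoint (Locations s₀ t₀) p → SegmentGraph s₀ t₀ p
  accumulation⊆graph {a , b} acc = a
    , ≤-up-to-ε 1# (λ ε 0<ε → let open Approximation (approximation acc ε 0<ε) in
        certify (gap -1≤x ⊕ gap x-a≤ε)
          (solve 3 (λ a x ε → a :+ κ 1 :* ε :- :- κ 1 := x :- :- κ 1 :+ (ε :- (x :- a))) refl a x ε))
    , ≤-up-to-ε 1# (λ ε 0<ε → let open Approximation (approximation acc ε 0<ε) in
        certify (gap x≤1 ⊕ gap a-x≤ε)
          (solve 3 (λ a x ε → κ 1 :+ κ 1 :* ε :- a := κ 1 :- x :+ (ε :- (a :- x))) refl a x ε))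
    , refl
    , segment-ordinate-unique (antisym (≤-up-to-ε K upper) (≤-up-to-ε K lower))
    where
    -- In the doubled equation, 2ε comes from b - y, ε from h (s + t), and (s₀ + t₀) ε from δ (a -
    -- x). Treating the two terms of δ = t₀ - s₀ separately avoids absolute values.
    K = 1# + 1# + 1# + σ

    upper : ∀ ε → 0# < ε → 2# * b ≤ σ + δ * a + K * ε
    upper ε 0<ε@(0≤ε , _) = certify
      (0≤2 ⊗ gap b-y≤ε ⊕ 0≤h*[s+t] ⊕ 0≤ε ⊕ 0≤s₀ ⊗ gap a-x≤ε ⊕ 0≤t₀ ⊗ gap x-a≤ε ⊕ slack (sym midpoint))
      (solve 8 (λ a b x y w s₀ t₀ ε →
          s₀ :+ t₀ :+ (t₀ :- s₀) :* a :+ (κ 3 :+ (s₀ :+ t₀)) :* ε :- κ 2 :* b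
          := κ 2 :* (ε :- (b :- y)) :+ w :+ ε :+ s₀ :* (ε :- (a :- x)) :+ t₀ :* (ε :- (x :- a))
             :+ (s₀ :+ t₀ :+ (t₀ :- s₀) :* x :- (κ 2 :* y :+ w)))
        refl a b x y (h * (s + t)) s₀ t₀ ε)
      where open Approximation (approximation acc ε 0<ε)

    lower : ∀ ε → 0# < ε → σ + δ * a ≤ 2# * b + K * ε
    lower ε 0<ε@(0≤ε , _) = certify
      (0≤2 ⊗ gap y-b≤ε ⊕ gap h*[s+t]≤ε ⊕ 0≤s₀ ⊗ gap x-a≤ε ⊕ 0≤t₀ ⊗ gap a-x≤ε ⊕ slack midpoint)
      (solve 8 (λ a b x y w s₀ t₀ ε →
          κ 2 :* b :+ (κ 3 :+ (s₀ :+ t₀)) :* ε :- (s₀ :+ t₀ :+ (t₀ :- s₀) :* a)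
          := κ 2 :* (ε :- (y :- b)) :+ (ε :- w) :+ s₀ :* (ε :- (x :- a)) :+ t₀ :* (ε :- (a :- x))
             :+ (κ 2 :* y :+ w :- (s₀ :+ t₀ :+ (t₀ :- s₀) :* x)))
        refl a b x y (h * (s + t)) s₀ t₀ ε)
      where open Approximation (approximation acc ε 0<ε)

  -- Points of the segment are accumulation points

  -- Delays keep the abscissa and the depth and lower s by 1, so the natural bound k on s is the
  -- recursion measure; k = 0 contradicts 1 ≤ s.
  split-descendant : ∀ k {x y d s t} → s ≤ fromℕ k → node (x , y) d s t ∈ 𝒯 s₀ t₀ →
    ∃[ y′ ] ∃[ s′ ] ∃[ t′ ] node (x , y′) d s′ t′ ∈ 𝒯 s₀ t₀ × (s′ < 2# ⊎ t′ < 2#)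
  split-descendant zero s≤0 n∈𝒯 = ⊥-elim (<⇒≱ 0<1 (≤-trans (Invariant.1≤s (invariant n∈𝒯)) s≤0))
  split-descendant (suc k) {x} {y} {d} {s} {t} s≤1+k n∈𝒯 = by-cases em em
    where
    by-cases : Dec (2# ≤ s) → Dec (2# ≤ t) →
      ∃[ y′ ] ∃[ s′ ] ∃[ t′ ] node (x , y′) d s′ t′ ∈ 𝒯 s₀ t₀ × (s′ < 2# ⊎ t′ < 2#)
    by-cases (no 2≰s)  _         = y , s , t , n∈𝒯 , inj₁ (≰⇒> 2≰s)
    by-cases (yes _)   (no 2≰t)  = y , s , t , n∈𝒯 , inj₂ (≰⇒> 2≰t)
    by-cases (yes 2≤s) (yes 2≤t) = split-descendant k
      (certify (gap (≤-respʳ (fromℕ-suc k) s≤1+k))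
        (solve 2 (λ s k → k :- (s :- κ 1) := κ 1 :+ k :- s) refl s (fromℕ k)))
      (delay∈ n∈𝒯 (2≤s , 2≤t))

  -- The abscissa a lies under the segment aimed at by some node of depth d, whose abscissas range
  -- from x - 2⁻ᵈ to x + 2⁻ᵈ.
  Covered : Carrier → ℕ → Set
  Covered a d = ∃[ x ] ∃[ y ] ∃[ s ] ∃[ t ]
    node (x , y) d s t ∈ 𝒯 s₀ t₀ × a - x ≤ 2^- d × x - a ≤ 2^- d

  -- The two children cover the halves of this range on either side of x, so the side on which a
  -- lies selects the child.
  split-covered : ∀ {a x y d s t} → node (x , y) d s t ∈ 𝒯 s₀ t₀ → s < 2# ⊎ t < 2# →
                  a - x ≤ 2^- d → x - a ≤ 2^- d → a ≤ x ⊎ x ≤ a → Covered a (suc d)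
  split-covered {a} {x} {d = d} n∈𝒯 split a-x≤h x-a≤h (inj₁ a≤x) =
    _ , _ , _ , _ , left∈ n∈𝒯 split
    , certify (gap a≤x) (solve 3 (λ a x h → h :- (a :- (x :- h)) := x :- a) refl a x (2^- (suc d)))
    , certify (gap x-a≤h ⊕ slack (sym (2^-d≈2*2^-1+d d)))
        (solve 4 (λ a x h h′ → h′ :- (x :- h′ :- a) := h :- (x :- a) :+ (κ 2 :* h′ :- h))
          refl a x (2^- d) (2^- (suc d)))
  split-covered {a} {x} {d = d} n∈𝒯 split a-x≤h x-a≤h (inj₂ x≤a) =
    _ , _ , _ , _ , right∈ n∈𝒯 split
    , certify (gap a-x≤h ⊕ slack (sym (2^-d≈2*2^-1+d d)))
        (solve 4 (λ a x h h′ → h′ :- (a :- (x :+ h′)) := h :- (a :- x) :+ (κ 2 :* h′ :- h))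
          refl a x (2^- d) (2^- (suc d)))
    , certify (gap x≤a) (solve 3 (λ a x h → h :- (x :+ h :- a) := a :- x) refl a x (2^- (suc d)))

  covering : ∀ {a} → - 1# ≤ a → a ≤ 1# → ∀ d → Covered a d
  covering {a} -1≤a a≤1 zero = 0# , 0# , s₀ , t₀ , root∈
    , certify (gap a≤1 ⊕ slack 2^-0≈1)
        (solve 2 (λ a h → h :- (a :- κ 0) := κ 1 :- a :+ (h :- κ 1)) refl a (2^- 0))
    , certify (gap -1≤a ⊕ slack 2^-0≈1)
        (solve 2 (λ a h → h :- (κ 0 :- a) := a :- :- κ 1 :+ (h :- κ 1)) refl a (2^- 0))
  covering {a} -1≤a a≤1 (suc d) =
    let x , _ , _ , _ , n∈𝒯 , a-x≤h , x-a≤h = covering -1≤a a≤1 d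
        _ , _ , _ , n′∈𝒯 , split = split-descendant C (s≤C (invariant n∈𝒯)) n∈𝒯
    in split-covered n′∈𝒯 split a-x≤h x-a≤h (total a x)

  graph⊆accumulation : ∀ {p} → SegmentGraph s₀ t₀ p → AccumulationPoint (Locations s₀ t₀) p
  graph⊆accumulation {a , b} (a′ , -1≤a′ , a′≤1 , a≈a′ , b≈) ε 0<ε@(0≤ε , _) =
    (x , y) , (node (x , y) d s t , n∈𝒯 , refl , refl) , distinct , close
    where
    -- As 2(b - y) = δ (a - x) + h (s + t), the slope contributes at most hσ and the height at most
    -- hM; this bounds the vertical error by hE.
    E = σ + M
    small = 2^-small (2# + E) 0<ε
    d = proj₁ small
    h = 2^- d
    0<h = 0<2^- d
    0≤h = 0≤2^- d

    cover = covering (≤-respʳ (sym a≈a′) -1≤a′) (≤-respˡ (sym a≈a′) a′≤1) d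
    x = proj₁ cover
    y = proj₁ (proj₂ cover)
    s = proj₁ (proj₂ (proj₂ cover))
    t = proj₁ (proj₂ (proj₂ (proj₂ cover)))
    n∈𝒯 = proj₁ (proj₂ (proj₂ (proj₂ (proj₂ cover))))
    a-x≤h = proj₁ (proj₂ (proj₂ (proj₂ (proj₂ (proj₂ cover)))))
    x-a≤h = proj₂ (proj₂ (proj₂ (proj₂ (proj₂ (proj₂ cover)))))
    open Invariant (invariant n∈𝒯)

    0≤E : 0# ≤ E
    0≤E = 0≤σ ⊕ 0≤M

    on-line : 2# * b ≈ σ + δ * a
    on-line = trans (*-congˡ b≈) (trans (2*segment-ordinate a′) (+-congˡ (*-congˡ (sym a≈a′))))

    distinct : ¬ ((x , y) ≈ₚ (a , b))
    -- A node at (a , b) would lie on the segment, but `midpoint` puts it strictly below, since h (s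
    -- + t) > 0.
    distinct (x≈a , y≈b) = 0<x⇒x≉0 (*-pos 0<h (<-+-nonneg (1≤x⇒0<x 1≤s) 0≤t))
      (equate (residue midpoint ⊕₀ (- 2#) ⊗₀ residue y≈b ⊕₀ δ ⊗₀ residue x≈a ⊕₀ (- 1#) ⊗₀ residue on-line)
        (solve 7 (λ a b x y w σ δ → w :- κ 0
            := κ 2 :* y :+ w :- (σ :+ δ :* x) :+ (:- κ 2) :* (y :- b) :+ δ :* (x :- a)
               :+ (:- κ 1) :* (κ 2 :* b :- (σ :+ δ :* a)))
          refl a b x y (h * (s + t)) σ δ))

    b-y≤hE : b - y ≤ h * E
    b-y≤hE = halve (certify
      (0≤s₀ ⊗ gap x-a≤h ⊕ 0≤t₀ ⊗ gap a-x≤h ⊕ 0≤h ⊗ gap s+t≤M ⊕ 0≤h ⊗ 0≤E ⊕ slack (sym on-line) ⊕ slack midpoint)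
      (solve 10 (λ a b x y h s t s₀ t₀ m →
          κ 2 :* (h :* (s₀ :+ t₀ :+ m)) :- κ 2 :* (b :- y)
          := s₀ :* (h :- (x :- a)) :+ t₀ :* (h :- (a :- x)) :+ h :* (m :- (s :+ t)) :+ h :* (s₀ :+ t₀ :+ m)
             :+ (s₀ :+ t₀ :+ (t₀ :- s₀) :* a :- κ 2 :* b)
             :+ (κ 2 :* y :+ h :* (s :+ t) :- (s₀ :+ t₀ :+ (t₀ :- s₀) :* x)))
        refl a b x y h s t s₀ t₀ M))

    y-b≤hE : y - b ≤ h * E
    y-b≤hE = halve (certify
      (0≤s₀ ⊗ gap a-x≤h ⊕ 0≤t₀ ⊗ gap x-a≤h ⊕ 0≤h ⊗ (0≤s ⊕ 0≤t) ⊕ 0≤h ⊗ (0≤E ⊕ 0≤M)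
        ⊕ slack on-line ⊕ slack (sym midpoint))
      (solve 10 (λ a b x y h s t s₀ t₀ m →
          κ 2 :* (h :* (s₀ :+ t₀ :+ m)) :- κ 2 :* (y :- b)
          := s₀ :* (h :- (a :- x)) :+ t₀ :* (h :- (x :- a)) :+ h :* (s :+ t) :+ h :* (s₀ :+ t₀ :+ m :+ m)
             :+ (κ 2 :* b :- (s₀ :+ t₀ :+ (t₀ :- s₀) :* a))
             :+ (s₀ :+ t₀ :+ (t₀ :- s₀) :* x :- (κ 2 :* y :+ h :* (s :+ t))))
        refl a b x y h s t s₀ t₀ M))

    -- (a − x)² + (b − y)² ≤ h² (1 + E²) < (h (2 + E))² ≤ ε²
    close : dist² (a , b) (x , y) < ε * ε
    close = <-≤-trans
      (certify-< (<-+-nonneg (<-+-nonneg (<-+-nonneg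
          (*-pos (*-pos 0<h 0<h) (1≤x⇒0<x 1≤3)) (0≤fromℕ 4 ⊗ (0≤h ⊗ 0≤h ⊗ 0≤E)))
          (gap a-x≤h ⊗ gap x-a≤h)) (gap b-y≤hE ⊗ gap y-b≤hE))
        (solve 6 (λ a b x y h E →
            h :* (κ 2 :+ E) :* (h :* (κ 2 :+ E)) :- ((a :- x) :* (a :- x) :+ (b :- y) :* (b :- y))
            := h :* h :* κ 3 :+ κ 4 :* (h :* h :* E) :+ (h :- (a :- x)) :* (h :- (x :- a))
               :+ (h :* E :- (b :- y)) :* (h :* E :- (y :- b)))
          refl a b x y h E))
      (square-mono (0≤h ⊗ (0≤2 ⊕ 0≤E)) (proj₂ small ℕ.≤-refl))

theorem1 : ExcludedMiddle 0ℓ →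
    (ℝ : CompleteOrderedField) →
    let open CompleteOrderedField ℝ
        open Plane ℝ
        open Tree ℝ
    in
    (s₀ t₀ : Carrier) → 1# ≤ s₀ → 1# ≤ t₀ →
    (AccumulationPoint (Locations s₀ t₀) ≐ ClosedSegment (- 1# , s₀) (1# , t₀))
    × (ClosedSegment (- 1# , s₀) (1# , t₀) ≐ SegmentGraph s₀ t₀)
theorem1 em ℝ s₀ t₀ 1≤s₀ 1≤t₀ =
  ( (λ acc → proj₂ segment≐graph (accumulation⊆graph acc))
  , (λ seg → graph⊆accumulation (proj₁ segment≐graph seg)) )
  , segment≐graph
  where
  open Segment em ℝ s₀ t₀
  open Construction em ℝ s₀ t₀ 1≤s₀ 1≤t₀
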